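{- Let $M_G$ be a mixed graph on $n$ vertices whose underlying graph $G$ is simple, finite and connected. Then $M_G$ has property $SP$ if and only if its Hermitian Laplacian matrix of the second kind $L(M_G)$ is singular.
   Context: A mixed graph $M_G$ is obtained from $G$ by giving directions to some of its edges. Let $\omega=\frac{1+\sqrt{3}\mathbf{i}}{2}$. $N(M_G)=(n_{ij})$ has $n_{ij}=1$ if $v_i,v_j$ are joined by an undirected edge, $n_{ij}=\omega$ if there is an edge directed $v_i\to v_j$, $n_{ij}=\overline{\omega}$ if directed $v_j\to v_i$, and $0$ otherwise; $L(M_G)=D(M_G)-N(M_G)$, with $D(M_G)$ the degree diagonal matrix of $G$. $M_G$ has property $SP$ if its vertex set can be partitioned into six (possibly empty) parts $V_1,\dots,V_6$ such that every undirected edge has both endpoints in the same part, and every directed edge goes from a vertex of $V_i$ to a vertex of $V_{i+1}$ for some $i\in\{1,\dots,5\}$, or from a vertex of $V_6$ to a vertex of $V_1$. -}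

module Defs where

open import Data.Nat as ℕ using (ℕ; zero; suc)
open import Data.Integer as ℤ using (ℤ; +_)
open import Data.Fin as Fin using (Fin; zero; suc; punchIn)
open import Data.Bool using (if_then_else_)
open import Data.Product using (Σ)
open import Data.Unit using (⊤)
open import Relation.Binary.PropositionalEquality using (_≡_)
open import Relation.Nullary using (¬_; does)
open import Relation.Binary.Construct.Closure.ReflexiveTransitive using (Star)

-- Eisenstein integers ℤ[ω], ω = (1 + √3 i)/2 = e^{iπ/3}.
-- An element  mkE a b  denotes  a + b·ω ∈ ℂ.  Since ω² = ω - 1 and
-- conj(ω) = 1 - ω, all entries of L(M_G) lie in this subring of ℂ,
-- and the inclusion ℤ[ω] ↪ ℂ is an injective ring homomorphism.

record Eis : Set where
  constructor mkE
  field
    re : ℤ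
    om : ℤ

0E 1E ωE ω̄E : Eis
0E  = mkE (+ 0) (+ 0)
1E  = mkE (+ 1) (+ 0)
ωE  = mkE (+ 0) (+ 1)
ω̄E = mkE (+ 1) (ℤ.- (+ 1))

infixl 6 _+E_ _-E_
infixl 7 _*E_

_+E_ : Eis → Eis → Eis
mkE a b +E mkE c d = mkE (a ℤ.+ c) (b ℤ.+ d)

-E_ : Eis → Eis
-E mkE a b = mkE (ℤ.- a) (ℤ.- b)

_-E_ : Eis → Eis → Eis
x -E y = x +E (-E y)

-- (a + bω)(c + dω) = ac + (ad + bc)ω + bd(ω - 1)
_*E_ : Eis → Eis → Eis
mkE a b *E mkE c d =
  mkE (a ℤ.* c ℤ.- b ℤ.* d) (a ℤ.* d ℤ.+ b ℤ.* c ℤ.+ b ℤ.* d)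

fromℕE : ℕ → Eis
fromℕE k = mkE (+ k) (+ 0)

sumℕ : ∀ {n} → (Fin n → ℕ) → ℕ
sumℕ {zero}  f = 0
sumℕ {suc n} f = f zero ℕ.+ sumℕ (λ i → f (suc i))

sumE : ∀ {n} → (Fin n → Eis) → Eis
sumE {zero}  f = 0E
sumE {suc n} f = f zero +E sumE (λ i → f (suc i))

signE : ℕ → Eis
signE zero    = 1E
signE (suc k) = -E signE k

det : ∀ {n} → (Fin n → Fin n → Eis) → Eis
det {zero}  A = 1E
det {suc n} A =
  sumE (λ j → signE (Fin.toℕ j) *E (A zero j *E det (λ r c → A (suc r) (punchIn j c))))

-- Mixed graphs on vertex set Fin n with simple underlying graph.
-- kind i j describes the relation between v_i and v_j:
--   none  : not adjacent
--   undir : undirected edge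
--   fwd   : edge directed v_i → v_j
--   bwd   : edge directed v_j → v_i

data EdgeKind : Set where
  none undir fwd bwd : EdgeKind

flipK : EdgeKind → EdgeKind
flipK none  = none
flipK undir = undir
flipK fwd   = bwd
flipK bwd   = fwd

record MixedGraph (n : ℕ) : Set where
  field
    kind        : Fin n → Fin n → EdgeKind
    kind-flip   : ∀ i j → kind j i ≡ flipK (kind i j)
    kind-irrefl : ∀ i → kind i i ≡ none
open MixedGraph public

Adj : ∀ {n} → MixedGraph n → Fin n → Fin n → Set
Adj M i j = ¬ (kind M i j ≡ none)

Connected : ∀ {n} → MixedGraph n → Set
Connected {n} M = ∀ (i j : Fin n) → Star (Adj M) i j

isEdge : EdgeKind → ℕ
isEdge none = 0
isEdge _    = 1

degree : ∀ {n} → MixedGraph n → Fin n → ℕ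
degree M i = sumℕ (λ j → isEdge (kind M i j))

entryN : EdgeKind → Eis
entryN none  = 0E
entryN undir = 1E
entryN fwd   = ωE
entryN bwd   = ω̄E

NMat : ∀ {n} → MixedGraph n → Fin n → Fin n → Eis
NMat M i j = entryN (kind M i j)

DMat : ∀ {n} → MixedGraph n → Fin n → Fin n → Eis
DMat M i j = if does (i Fin.≟ j) then fromℕE (degree M i) else 0E

LMat : ∀ {n} → MixedGraph n → Fin n → Fin n → Eis
LMat M i j = DMat M i j -E NMat M i j

Singular : ∀ {n} → (Fin n → Fin n → Eis) → Set
Singular A = det A ≡ 0E

-- Property SP: a labelling p : V → {1,…,6} (parts V_1..V_6, possibly empty)

next6 : Fin 6 → Fin 6
next6 zero                               = suc zero
next6 (suc zero)                         = suc (suc zero)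
next6 (suc (suc zero))                   = suc (suc (suc zero))
next6 (suc (suc (suc zero)))             = suc (suc (suc (suc zero)))
next6 (suc (suc (suc (suc zero))))       = suc (suc (suc (suc (suc zero))))
next6 (suc (suc (suc (suc (suc zero))))) = zero

SPcond : EdgeKind → Fin 6 → Fin 6 → Set
SPcond none  a b = ⊤
SPcond undir a b = a ≡ b
SPcond fwd   a b = b ≡ next6 a
SPcond bwd   a b = a ≡ next6 b

HasSP : ∀ {n} → MixedGraph n → Set
HasSP {n} M = Σ (Fin n → Fin 6) (λ p → ∀ i j → SPcond (kind M i j) (p i) (p j))

{-# OPTIONS --safe #-}
-- Singularity of L over the domain ℤ[ω] means L x = 0 for some x ≠ 0.  The
-- Hermitian form x* L x is a sum of |x_i - n_ij x_j|² over the edges, so L x = 0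
-- forces x_i = n_ij x_j along every edge.  By connectedness all entries are then
-- multiples ω^{-p(i)} x_0 of one nonzero entry, and p is a labelling witnessing
-- SP; conversely a labelling p gives the kernel vector x_i = ω^{-p(i)}.
module Submission where

open import Defs
open import Data.Nat using (ℕ; _≤_)
open import Function.Bundles using (_⇔_)
open import Algebra.Bundles using (CommutativeRing)
import Algebra.Consequences.Propositional as Consequences
import Algebra.Properties.Group as GroupProperties
import Algebra.Properties.Semiring.Sum as SemiringSum
open import Algebra.Structures using (IsCommutativeRing)
open import Data.Bool using (if_then_else_)
open import Data.Fin as Fin using (Fin; zero; suc; punchIn; punchOut; inject₁; toℕ)
open import Data.Fin.Induction using (<-weakInduction)
import Data.Fin.Properties as Finₚ
open import Data.Integer as ℤ using (ℤ; +_; -[1+_]; +≤+)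
import Data.Integer.Properties as ℤₚ
open import Data.Integer.Solver using (module +-*-Solver)
open import Data.Maybe using (just; nothing)
open import Data.Nat using (zero; suc; z≤n; s≤s)
import Data.Nat.Properties as ℕₚ
open import Data.Product using (∃; _×_; _,_; proj₁; proj₂)
open import Data.Sum as Sum using (_⊎_; inj₁; inj₂; [_,_]′)
open import Data.Unit using (tt)
open import Data.Vec.Functional using (insertAt)
import Data.Vec.Functional.Properties as Vecₚ
open import Function using (_∘_; id)
open import Function.Bundles using (mk⇔)
open import Level using (0ℓ)
open import Relation.Binary.Construct.Closure.ReflexiveTransitive using (Star; ε; _◅_)
open import Relation.Binary.Definitions using (tri<; tri≈; tri>)
open import Relation.Binary.PropositionalEquality
open import Relation.Nullary using (Dec; yes; no; does; contradiction)
open import Relation.Nullary.Decidable using (¬?; dec-true; dec-false; decidable-stable; from-yes; map′; _×-dec_; _→-dec_)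
open import Tactic.RingSolver.Core.AlmostCommutativeRing using (AlmostCommutativeRing; fromCommutativeRing)

-- The linear algebra stays inside ℤ[ω], so no step divides: kernel vectors are built fraction-free,
-- and a nonzero factor is removed by cancellation in a domain. As `det` expands along the first
-- row, multilinearity and alternation are proved for columns; they yield Cramer's rule in the
-- product form `det (A [ k ≔ A · x ]) ≡ x k *E det A`, the bridge between determinants and kernels
-- in both directions. The Hermitian form is doubled because real parts in ℤ[ω] are half-integers;
-- positivity then becomes an argument in the ordered ring ℤ.

-- The ring of Eisenstein integers

module ℤS = +-*-Solver
open ℤS using (Polynomial; con; _:+_; _:*_; _:-_; _:=_)

-- Formal Eisenstein integers, with operations mirroring those on Eis, so that
-- identities between Eisenstein integers can be handed to the integer solver.
Eis[_] : ℕ → Set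
Eis[ n ] = Polynomial n × Polynomial n

infixl 6 _:+E_ _:-E_
infixl 7 _:*E_
_:+E_ _:-E_ _:*E_ : ∀ {n} → Eis[ n ] → Eis[ n ] → Eis[ n ]
(a , b) :+E (c , d) = (a :+ c) , (b :+ d)
(a , b) :-E (c , d) = (a :- c) , (b :- d)
(a , b) :*E (c , d) = (a :* c :- b :* d) , (a :* d :+ b :* c :+ b :* d)

conE : ∀ {n} → Eis → Eis[ n ]
conE (mkE a b) = con a , con b

-- The integer 2 Re(x̄ y).
⟨_,_⟩ : Eis → Eis → ℤ
⟨ mkE a b , mkE c d ⟩ = a ℤ.* c ℤ.+ b ℤ.* d ℤ.+ (a ℤ.+ b) ℤ.* (c ℤ.+ d)

:⟨_,_⟩ : ∀ {n} → Eis[ n ] → Eis[ n ] → Polynomial n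
:⟨ (a , b) , (c , d) ⟩ = a :* c :+ b :* d :+ (a :+ b) :* (c :+ d)

*E-assoc : ∀ x y z → (x *E y) *E z ≡ x *E (y *E z)
*E-assoc (mkE a b) (mkE c d) (mkE e f) = cong₂ mkE
  (ℤS.solve 6 (λ a b c d e f → proj₁ (law (a , b) (c , d) (e , f)) := proj₁ (law′ (a , b) (c , d) (e , f))) refl
    a b c d e f)
  (ℤS.solve 6 (λ a b c d e f → proj₂ (law (a , b) (c , d) (e , f)) := proj₂ (law′ (a , b) (c , d) (e , f))) refl
    a b c d e f)
  where
  law law′ : ∀ {n} → Eis[ n ] → Eis[ n ] → Eis[ n ] → Eis[ n ]
  law  x y z = (x :*E y) :*E z
  law′ x y z = x :*E (y :*E z)

*E-comm : ∀ x y → x *E y ≡ y *E x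
*E-comm (mkE a b) (mkE c d) = cong₂ mkE
  (ℤS.solve 4 (λ a b c d → proj₁ ((a , b) :*E (c , d)) := proj₁ ((c , d) :*E (a , b))) refl a b c d)
  (ℤS.solve 4 (λ a b c d → proj₂ ((a , b) :*E (c , d)) := proj₂ ((c , d) :*E (a , b))) refl a b c d)

*E-identityˡ : ∀ x → 1E *E x ≡ x
*E-identityˡ (mkE a b) = cong₂ mkE
  (ℤS.solve 2 (λ a b → proj₁ (conE 1E :*E (a , b)) := a) refl a b)
  (ℤS.solve 2 (λ a b → proj₂ (conE 1E :*E (a , b)) := b) refl a b)

*E-distribˡ-+E : ∀ x y z → x *E (y +E z) ≡ x *E y +E x *E z
*E-distribˡ-+E (mkE a b) (mkE c d) (mkE e f) = cong₂ mkE
  (ℤS.solve 6 (λ a b c d e f → proj₁ (law (a , b) (c , d) (e , f)) := proj₁ (law′ (a , b) (c , d) (e , f))) refl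
    a b c d e f)
  (ℤS.solve 6 (λ a b c d e f → proj₂ (law (a , b) (c , d) (e , f)) := proj₂ (law′ (a , b) (c , d) (e , f))) refl
    a b c d e f)
  where
  law law′ : ∀ {n} → Eis[ n ] → Eis[ n ] → Eis[ n ] → Eis[ n ]
  law  x y z = x :*E (y :+E z)
  law′ x y z = x :*E y :+E x :*E z

+E-comm : ∀ x y → x +E y ≡ y +E x
+E-comm (mkE a b) (mkE c d) = cong₂ mkE (ℤₚ.+-comm a c) (ℤₚ.+-comm b d)

+E-*E-isCommutativeRing : IsCommutativeRing _≡_ _+E_ _*E_ (λ x → -E x) 0E 1E
+E-*E-isCommutativeRing = record
  { isRing = record
    { +-isAbelianGroup = record
      { isGroup = record
        { isMonoid = record
          { isSemigroup = record
            { isMagma = record { isEquivalence = isEquivalence ; ∙-cong = cong₂ _+E_ }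
            ; assoc = λ x y z → cong₂ mkE (ℤₚ.+-assoc (Eis.re x) _ _) (ℤₚ.+-assoc (Eis.om x) _ _) }
          ; identity = Consequences.comm∧idˡ⇒id +E-comm (λ x → cong₂ mkE (ℤₚ.+-identityˡ _) (ℤₚ.+-identityˡ _)) }
        ; inverse = Consequences.comm∧invˡ⇒inv +E-comm (λ x → cong₂ mkE (ℤₚ.+-inverseˡ (Eis.re x)) (ℤₚ.+-inverseˡ (Eis.om x)))
        ; ⁻¹-cong = cong (λ x → -E x) }
      ; comm = +E-comm }
    ; *-cong = cong₂ _*E_
    ; *-assoc = *E-assoc
    ; *-identity = Consequences.comm∧idˡ⇒id *E-comm *E-identityˡ
    ; distrib = Consequences.comm∧distrˡ⇒distr (cong₂ _+E_) *E-comm *E-distribˡ-+E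
    }
  ; *-comm = *E-comm
  }

Eis-ring : CommutativeRing 0ℓ 0ℓ
Eis-ring = record { isCommutativeRing = +E-*E-isCommutativeRing }

Eis-acr : AlmostCommutativeRing 0ℓ 0ℓ
Eis-acr = fromCommutativeRing Eis-ring λ { (mkE (+ 0) (+ 0)) → just refl ; _ → nothing }

open import Tactic.RingSolver.NonReflective Eis-acr using (solve; _⊕_; _⊗_; ⊝_; _⊜_; Κ)

infix 4 _≟E_
_≟E_ : (x y : Eis) → Dec (x ≡ y)
mkE a b ≟E mkE c d =
  map′ (λ (p , q) → cong₂ mkE p q) (λ p → cong Eis.re p , cong Eis.om p) (a ℤ.≟ c ×-dec b ℤ.≟ d)

-- The norm form and the absence of zero divisors

nonneg-+≡0 : ∀ {u v} → + 0 ℤ.≤ u → + 0 ℤ.≤ v → u ℤ.+ v ≡ + 0 → u ≡ + 0 × v ≡ + 0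
nonneg-+≡0 {+ m} {+ n} _ _ eq =
  cong +_ (ℕₚ.m+n≡0⇒m≡0 m (ℤₚ.+-injective eq)) , cong +_ (ℕₚ.m+n≡0⇒n≡0 m (ℤₚ.+-injective eq))

square-nonneg : ∀ a → + 0 ℤ.≤ a ℤ.* a
square-nonneg (+ n)    = subst (+ 0 ℤ.≤_) (ℤₚ.pos-* n n) (+≤+ z≤n)
square-nonneg -[1+ n ] = +≤+ z≤n

square≡0 : ∀ a → a ℤ.* a ≡ + 0 → a ≡ + 0
square≡0 a eq = [ id , id ]′ (ℤₚ.i*j≡0⇒i≡0∨j≡0 a eq)

-- On the diagonal the form is a² + b² + (a + b)², a sum of three squares.
⟨x,x⟩-nonneg : ∀ x → + 0 ℤ.≤ ⟨ x , x ⟩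
⟨x,x⟩-nonneg (mkE a b) =
  ℤₚ.+-mono-≤ (ℤₚ.+-mono-≤ (square-nonneg a) (square-nonneg b)) (square-nonneg (a ℤ.+ b))

⟨x,x⟩≡0⇒x≡0 : ∀ x → ⟨ x , x ⟩ ≡ + 0 → x ≡ 0E
⟨x,x⟩≡0⇒x≡0 (mkE a b) eq
  with p , _ ← nonneg-+≡0 (ℤₚ.+-mono-≤ (square-nonneg a) (square-nonneg b)) (square-nonneg (a ℤ.+ b)) eq
  with q , r ← nonneg-+≡0 (square-nonneg a) (square-nonneg b) p
  = cong₂ mkE (square≡0 a q) (square≡0 b r)

-- This is |x|²|y|² = |xy|² for the doubled norm ⟨x,x⟩ = 2|x|², whence the factor 2.
⟨⟩-multiplicative : ∀ x y → ⟨ x , x ⟩ ℤ.* ⟨ y , y ⟩ ≡ + 2 ℤ.* ⟨ x *E y , x *E y ⟩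
⟨⟩-multiplicative (mkE a b) (mkE c d) = ℤS.solve 4
  (λ a b c d → let x = a , b ; y = c , d in
    :⟨ x , x ⟩ :* :⟨ y , y ⟩ := con (+ 2) :* :⟨ x :*E y , x :*E y ⟩) refl
  a b c d

x*y≡0⇒x≡0⊎y≡0 : ∀ x y → x *E y ≡ 0E → x ≡ 0E ⊎ y ≡ 0E
x*y≡0⇒x≡0⊎y≡0 x y eq = Sum.map (⟨x,x⟩≡0⇒x≡0 x) (⟨x,x⟩≡0⇒x≡0 y)
  (ℤₚ.i*j≡0⇒i≡0∨j≡0 ⟨ x , x ⟩ (trans (⟨⟩-multiplicative x y) (cong (λ z → + 2 ℤ.* ⟨ z , z ⟩) eq)))

x*y≡0∧x≢0⇒y≡0 : ∀ {x y} → x *E y ≡ 0E → x ≢ 0E → y ≡ 0E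
x*y≡0∧x≢0⇒y≡0 {x} {y} eq x≢0 = [ (λ p → contradiction p x≢0) , id ]′ (x*y≡0⇒x≡0⊎y≡0 x y eq)

module E = CommutativeRing Eis-ring
module ΣE = SemiringSum E.semiring
module Σℤ = SemiringSum (CommutativeRing.semiring ℤₚ.+-*-commutativeRing)

sumE≡sum : ∀ {n} (f : Fin n → Eis) → sumE f ≡ ΣE.sum f
sumE≡sum {zero}  f = refl
sumE≡sum {suc n} f = cong (f zero +E_) (sumE≡sum (f ∘ suc))

sumE-cong : ∀ {n} {f g : Fin n → Eis} → (∀ i → f i ≡ g i) → sumE f ≡ sumE g
sumE-cong {zero}  eq = refl
sumE-cong {suc n} eq = cong₂ _+E_ (eq zero) (sumE-cong (eq ∘ suc))

sumE-zero : ∀ {n} {f : Fin n → Eis} → (∀ i → f i ≡ 0E) → sumE f ≡ 0E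
sumE-zero {zero}  eq = refl
sumE-zero {suc n} eq = cong₂ _+E_ (eq zero) (sumE-zero (eq ∘ suc))

sumE-linear : ∀ {n} s t (f g : Fin n → Eis) →
  sumE (λ i → s *E f i +E t *E g i) ≡ s *E sumE f +E t *E sumE g
sumE-linear {zero}  s t f g = solve 2 (λ s t → Κ 0E ⊜ (s ⊗ Κ 0E ⊕ t ⊗ Κ 0E)) refl s t
sumE-linear {suc n} s t f g = trans (cong ((s *E f zero +E t *E g zero) +E_) (sumE-linear s t (f ∘ suc) (g ∘ suc)))
  (solve 6 (λ s t a b c d → ((s ⊗ a ⊕ t ⊗ b) ⊕ (s ⊗ c ⊕ t ⊗ d)) ⊜ (s ⊗ (a ⊕ c) ⊕ t ⊗ (b ⊕ d))) refl
    s t (f zero) (g zero) (sumE (f ∘ suc)) (sumE (g ∘ suc)))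

sumE-punchIn : ∀ {n} k (f : Fin (suc n) → Eis) → sumE f ≡ f k +E sumE (f ∘ punchIn k)
sumE-punchIn k f = begin
  sumE f                              ≡⟨ sumE≡sum f ⟩
  ΣE.sum f                            ≡⟨ ΣE.sum-remove {i = k} f ⟩
  f k +E ΣE.sum (f ∘ punchIn k)       ≡⟨ cong (f k +E_) (sumE≡sum (f ∘ punchIn k)) ⟨
  f k +E sumE (f ∘ punchIn k)         ∎
  where open ≡-Reasoning

sumE-single : ∀ {n} k (f : Fin n → Eis) → (∀ j → j ≢ k → f j ≡ 0E) → sumE f ≡ f k
sumE-single {suc n} k f eq = trans (sumE-punchIn k f)
  (trans (cong (f k +E_) (sumE-zero (λ c → eq (punchIn k c) (Finₚ.punchInᵢ≢i k c)))) (E.+-identityʳ (f k)))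

-- Determinants and kernels

Matrix : ℕ → ℕ → Set
Matrix m n = Fin m → Fin n → Eis

minor : ∀ {n} → Matrix (suc n) (suc n) → Fin (suc n) → Matrix n n
minor A j r c = A (suc r) (punchIn j c)

det-cong : ∀ {n} {A B : Matrix n n} → (∀ r c → A r c ≡ B r c) → det A ≡ det B
det-cong {zero}  eq = refl
det-cong {suc n} eq = sumE-cong λ j →
  cong (signE (toℕ j) *E_) (cong₂ _*E_ (eq zero j) (det-cong (λ r c → eq (suc r) (punchIn j c))))

-- In the first-row expansion, the term at k is linear through its entry and every other term
-- through its minor, by induction. Stating it for three matrices that agree off one column lets the
-- hypotheses pass to the minors, where column k sits at `punchOut j≢k`.
det-linear : ∀ {n} (A B C : Matrix n n) k s t →
  (∀ r c → c ≢ k → A r c ≡ C r c) → (∀ r c → c ≢ k → B r c ≡ C r c) →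
  (∀ r → C r k ≡ s *E A r k +E t *E B r k) →
  det C ≡ s *E det A +E t *E det B
det-linear {suc n} A B C k s t A≈C B≈C Ck =
  trans (sumE-cong (λ j → expand j (j Fin.≟ k))) (sumE-linear s t (term A) (term B))
  where
  term : Matrix (suc n) (suc n) → Fin (suc n) → Eis
  term X j = signE (toℕ j) *E (X zero j *E det (minor X j))

  off : ∀ {j} (j≢k : j ≢ k) c → c ≢ punchOut j≢k → punchIn j c ≢ k
  off {j} j≢k c c≢ eq = c≢ (Finₚ.punchIn-injective j c _ (trans eq (sym (Finₚ.punchIn-punchOut j≢k))))

  expand : ∀ j → Dec (j ≡ k) → term C j ≡ s *E term A j +E t *E term B j
  expand j (yes refl) = begin
    σ *E (C zero k *E det (minor C k))
      ≡⟨ cong (λ z → σ *E (z *E det (minor C k))) (Ck zero) ⟩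
    σ *E ((s *E A zero k +E t *E B zero k) *E det (minor C k))
      ≡⟨ solve 6 (λ σ s t a b m → σ ⊗ ((s ⊗ a ⊕ t ⊗ b) ⊗ m) ⊜ (s ⊗ (σ ⊗ (a ⊗ m)) ⊕ t ⊗ (σ ⊗ (b ⊗ m)))) refl
           σ s t (A zero k) (B zero k) (det (minor C k)) ⟩
    s *E (σ *E (A zero k *E det (minor C k))) +E t *E (σ *E (B zero k *E det (minor C k)))
      ≡⟨ cong₂ (λ a b → s *E (σ *E (A zero k *E a)) +E t *E (σ *E (B zero k *E b)))
           (det-cong (λ r c → sym (A≈C (suc r) (punchIn k c) (Finₚ.punchInᵢ≢i k c))))
           (det-cong (λ r c → sym (B≈C (suc r) (punchIn k c) (Finₚ.punchInᵢ≢i k c)))) ⟩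
    s *E term A k +E t *E term B k ∎
    where
    open ≡-Reasoning
    σ = signE (toℕ k)
  expand j (no j≢k) = begin
    σ *E (C zero j *E det (minor C j))
      ≡⟨ cong (λ z → σ *E (C zero j *E z))
           (det-linear (minor A j) (minor B j) (minor C j) (punchOut j≢k) s t
             (λ r c c≢ → A≈C (suc r) (punchIn j c) (off j≢k c c≢))
             (λ r c c≢ → B≈C (suc r) (punchIn j c) (off j≢k c c≢))
             (λ r → subst (λ l → C (suc r) l ≡ s *E A (suc r) l +E t *E B (suc r) l)
               (sym (Finₚ.punchIn-punchOut j≢k)) (Ck (suc r)))) ⟩
    σ *E (C zero j *E (s *E det (minor A j) +E t *E det (minor B j)))
      ≡⟨ solve 6 (λ σ s t a m l → σ ⊗ (a ⊗ (s ⊗ m ⊕ t ⊗ l)) ⊜ (s ⊗ (σ ⊗ (a ⊗ m)) ⊕ t ⊗ (σ ⊗ (a ⊗ l)))) refl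
           σ s t (C zero j) (det (minor A j)) (det (minor B j)) ⟩
    s *E (σ *E (C zero j *E det (minor A j))) +E t *E (σ *E (C zero j *E det (minor B j)))
      ≡⟨ cong₂ (λ a b → s *E (σ *E (a *E det (minor A j))) +E t *E (σ *E (b *E det (minor B j))))
           (sym (A≈C zero j j≢k)) (sym (B≈C zero j j≢k)) ⟩
    s *E term A j +E t *E term B j ∎
    where
    open ≡-Reasoning
    σ = signE (toℕ j)

det-zero-column : ∀ {n} (A : Matrix n n) k → (∀ r → A r k ≡ 0E) → det A ≡ 0E
det-zero-column A k eq = trans
  (det-linear A A A k 0E 0E (λ _ _ _ → refl) (λ _ _ _ → refl)
    (λ r → trans (eq r) (solve 1 (λ a → Κ 0E ⊜ (Κ 0E ⊗ a ⊕ Κ 0E ⊗ a)) refl (A r k))))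
  (solve 1 (λ a → (Κ 0E ⊗ a ⊕ Κ 0E ⊗ a) ⊜ Κ 0E) refl (det A))

infixl 8 _[_≔_]
_[_≔_] : ∀ {m n} → Matrix m n → Fin n → (Fin m → Eis) → Matrix m n
(A [ k ≔ v ]) r c = if does (c Fin.≟ k) then v r else A r c

≔-here : ∀ {m n} (A : Matrix m n) k v r → (A [ k ≔ v ]) r k ≡ v r
≔-here A k v r rewrite dec-true (k Fin.≟ k) refl = refl

≔-there : ∀ {m n} (A : Matrix m n) {k c} v r → c ≢ k → (A [ k ≔ v ]) r c ≡ A r c
≔-there A {k} {c} v r c≢k rewrite dec-false (c Fin.≟ k) c≢k = refl

≔-cong : ∀ {m n} {A B : Matrix m n} {k v w} → (∀ r c → c ≢ k → A r c ≡ B r c) → (∀ r → v r ≡ w r) →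
  ∀ r c → (A [ k ≔ v ]) r c ≡ (B [ k ≔ w ]) r c
≔-cong {k = k} A≈B v≈w r c with c Fin.≟ k
... | yes _  = v≈w r
... | no c≢k = A≈B r c c≢k

det-≔-linear : ∀ {n} (A : Matrix n n) k s t v w →
  det (A [ k ≔ (λ r → s *E v r +E t *E w r) ]) ≡ s *E det (A [ k ≔ v ]) +E t *E det (A [ k ≔ w ])
det-≔-linear A k s t v w = det-linear (A [ k ≔ v ]) (A [ k ≔ w ]) (A [ k ≔ z ]) k s t
  (λ r c c≢k → trans (≔-there A v r c≢k) (sym (≔-there A z r c≢k)))
  (λ r c c≢k → trans (≔-there A w r c≢k) (sym (≔-there A z r c≢k)))
  (λ r → trans (≔-here A k z r)
    (sym (cong₂ (λ a b → s *E a +E t *E b) (≔-here A k v r) (≔-here A k w r))))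
  where
  z = λ r → s *E v r +E t *E w r

infixr 7 _·_
_·_ : ∀ {m n} → Matrix m n → (Fin n → Eis) → Fin m → Eis
(A · x) r = sumE (λ c → A r c *E x c)

-- `V` has a width of its own, so that the induction can peel off its columns while `A` stays fixed.
det-≔-sum : ∀ {m n} (A : Matrix n n) k (V : Matrix n m) x →
  det (A [ k ≔ V · x ]) ≡ sumE (λ j → x j *E det (A [ k ≔ (λ r → V r j) ]))
det-≔-sum {zero}  A k V x = det-zero-column (A [ k ≔ V · x ]) k (≔-here A k (V · x))
det-≔-sum {suc m} A k V x = begin
  det (A [ k ≔ V · x ])
    ≡⟨ det-cong (≔-cong {A = A} (λ _ _ _ → refl) (λ r →
         solve 3 (λ a x s → (a ⊗ x ⊕ s) ⊜ (x ⊗ a ⊕ Κ 1E ⊗ s)) refl (V r zero) (x zero) ((V′ · x′) r))) ⟩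
  det (A [ k ≔ (λ r → x zero *E V r zero +E 1E *E (V′ · x′) r) ])
    ≡⟨ det-≔-linear A k (x zero) 1E (λ r → V r zero) (V′ · x′) ⟩
  x zero *E det (A [ k ≔ (λ r → V r zero) ]) +E 1E *E det (A [ k ≔ V′ · x′ ])
    ≡⟨ cong (x zero *E det (A [ k ≔ (λ r → V r zero) ]) +E_)
         (trans (E.*-identityˡ (det (A [ k ≔ V′ · x′ ]))) (det-≔-sum A k V′ x′)) ⟩
  sumE (λ j → x j *E det (A [ k ≔ (λ r → V r j) ])) ∎
  where
  open ≡-Reasoning
  V′ : Matrix _ m
  V′ r c = V r (suc c)
  x′ : Fin m → Eis
  x′ = x ∘ suc

-- Determinants with two equal columns

sumE-adjacent : ∀ {n} (f : Fin (suc n) → Eis) k → f (inject₁ k) +E f (suc k) ≡ 0E →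
  (∀ j → j ≢ inject₁ k → j ≢ suc k → f j ≡ 0E) → sumE f ≡ 0E
sumE-adjacent f zero pair rest = begin
  f zero +E (f (suc zero) +E sumE (λ i → f (suc (suc i))))
    ≡⟨ cong (λ z → f zero +E (f (suc zero) +E z)) (sumE-zero (λ i → rest (suc (suc i)) (λ ()) (λ ()))) ⟩
  f zero +E (f (suc zero) +E 0E)
    ≡⟨ cong (f zero +E_) (E.+-identityʳ (f (suc zero))) ⟩
  f zero +E f (suc zero)
    ≡⟨ pair ⟩
  0E ∎
  where open ≡-Reasoning
sumE-adjacent f (suc k) pair rest =
  cong₂ _+E_ (rest zero (λ ()) (λ ()))
    (sumE-adjacent (f ∘ suc) k pair
      (λ j j≢k j≢sk → rest (suc j) (j≢k ∘ Finₚ.suc-injective) (j≢sk ∘ Finₚ.suc-injective)))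

-- Keeps the induction of `det-equal-adjacent` among adjacent columns: a minor that retains both
-- equal columns still has them side by side.
punchIn-adjacent : ∀ {n} (j : Fin (suc (suc n))) (k : Fin (suc n)) → j ≢ inject₁ k → j ≢ suc k →
  ∃ λ (l : Fin n) → punchIn j (inject₁ l) ≡ inject₁ k × punchIn j (suc l) ≡ suc k
punchIn-adjacent zero zero j≢k _ = contradiction refl j≢k
punchIn-adjacent zero (suc k) _ _ = k , refl , refl
punchIn-adjacent (suc zero) zero _ j≢sk = contradiction refl j≢sk
punchIn-adjacent {suc n} (suc (suc j)) zero _ _ = zero , refl , refl
punchIn-adjacent {suc n} (suc j) (suc k) j≢k j≢sk
  with l , p , q ← punchIn-adjacent j k (j≢k ∘ cong suc) (j≢sk ∘ cong suc)
  = suc l , cong suc p , cong suc q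

punchIn-equal-adjacent : ∀ {n} (f : Fin (suc n) → Eis) k → f (inject₁ k) ≡ f (suc k) →
  ∀ c → f (punchIn (inject₁ k) c) ≡ f (punchIn (suc k) c)
punchIn-equal-adjacent f zero    eq zero    = sym eq
punchIn-equal-adjacent f zero    eq (suc c) = refl
punchIn-equal-adjacent f (suc k) eq zero    = refl
punchIn-equal-adjacent f (suc k) eq (suc c) = punchIn-equal-adjacent (f ∘ suc) k eq c

-- The terms at the two equal columns have equal entries and equal minors but, by adjacency,
-- opposite signs. Every other minor inherits the equal adjacent columns and vanishes by induction.
det-equal-adjacent : ∀ {n} (A : Matrix (suc n) (suc n)) k →
  (∀ r → A r (inject₁ k) ≡ A r (suc k)) → det A ≡ 0E
det-equal-adjacent {suc n} A k eq =
  sumE-adjacent (λ j → signE (toℕ j) *E (A zero j *E det (minor A j))) k pair rest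
  where
  pair : signE (toℕ (inject₁ k)) *E (A zero (inject₁ k) *E det (minor A (inject₁ k)))
      +E signE (toℕ (suc k)) *E (A zero (suc k) *E det (minor A (suc k))) ≡ 0E
  pair = begin
    signE (toℕ (inject₁ k)) *E (A zero (inject₁ k) *E det (minor A (inject₁ k))) +E (-E σ) *E z
      ≡⟨ cong (_+E (-E σ) *E z) (cong₂ _*E_ (cong signE (Finₚ.toℕ-inject₁ k)) (cong₂ _*E_ (eq zero)
           (det-cong (λ r → punchIn-equal-adjacent (A (suc r)) k (eq (suc r)))))) ⟩
    σ *E z +E (-E σ) *E z
      ≡⟨ solve 2 (λ σ z → (σ ⊗ z ⊕ (⊝ σ) ⊗ z) ⊜ Κ 0E) refl σ z ⟩
    0E ∎
    where
    open ≡-Reasoning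
    σ = signE (toℕ k)
    z = A zero (suc k) *E det (minor A (suc k))

  minor-0 : ∀ j → (∃ λ l → punchIn j (inject₁ l) ≡ inject₁ k × punchIn j (suc l) ≡ suc k) →
    det (minor A j) ≡ 0E
  minor-0 j (l , p , q) = det-equal-adjacent (minor A j) l
    (λ r → trans (cong (A (suc r)) p) (trans (eq (suc r)) (cong (A (suc r)) (sym q))))

  rest : ∀ j → j ≢ inject₁ k → j ≢ suc k → signE (toℕ j) *E (A zero j *E det (minor A j)) ≡ 0E
  rest j j≢k j≢sk = trans
    (cong (λ z → signE (toℕ j) *E (A zero j *E z)) (minor-0 j (punchIn-adjacent j k j≢k j≢sk)))
    (solve 2 (λ σ z → σ ⊗ (z ⊗ Κ 0E) ⊜ Κ 0E) refl (signE (toℕ j)) (A zero j))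

-- With u, w in the adjacent columns i, i+1 and w in column p < i, expand the
-- determinant with u + w in both adjacent columns: every summand but det A has
-- equal columns that are adjacent or, by induction, lie at p and i.
det-equal-< : ∀ {n} (q : Fin (suc n)) p → p Fin.< q → (A : Matrix (suc n) (suc n)) →
  (∀ r → A r p ≡ A r q) → det A ≡ 0E
det-equal-< {n} = <-weakInduction P (λ _ ()) step
  where
  P : Fin (suc n) → Set
  P q = ∀ p → p Fin.< q → (A : Matrix (suc n) (suc n)) → (∀ r → A r p ≡ A r q) → det A ≡ 0E

  step : ∀ i → P (inject₁ i) → P (suc i)
  step i ih p p<q A eq = cases (p Fin.≟ inject₁ i)
    where
    cases : Dec (p ≡ inject₁ i) → det A ≡ 0E
    cases (yes refl) = det-equal-adjacent A i eq
    cases (no p≢i) = begin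
      det A                                            ≡⟨ det-cong A≈ ⟩
      D u w
        -- The expansion of `D u+w u+w` is run backwards: the three zeros introduced here become
        -- `D u u`, `D w u` and `D w w`.
        ≡⟨ solve 1 (λ d → d ⊜ (Κ 1E ⊗ (Κ 1E ⊗ Κ 0E ⊕ Κ 1E ⊗ d) ⊕ Κ 1E ⊗ (Κ 1E ⊗ Κ 0E ⊕ Κ 1E ⊗ Κ 0E))) refl
             (D u w) ⟩
      1E *E (1E *E 0E +E 1E *E D u w) +E 1E *E (1E *E 0E +E 1E *E 0E)
        ≡⟨ cong₂ (λ a b → 1E *E a +E 1E *E b)
             (cong (λ z → 1E *E z +E 1E *E D u w) (sym (D-diag u)))
             (cong₂ (λ a b → 1E *E a +E 1E *E b) (sym D-w) (sym (D-diag w))) ⟩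
      1E *E (1E *E D u u +E 1E *E D u w) +E 1E *E (1E *E D w u +E 1E *E D w w)
        ≡⟨ cong₂ (λ a b → 1E *E a +E 1E *E b) (sym (split u)) (sym (split w)) ⟩
      1E *E D u u+w +E 1E *E D w u+w                   ≡⟨ sym splitˡ ⟩
      D u+w u+w                                        ≡⟨ D-diag u+w ⟩
      0E                                               ∎
      where
      open ≡-Reasoning
      Column = Fin (suc n) → Eis
      u w u+w : Column
      u r = A r (inject₁ i)
      w r = A r (suc i)
      u+w r = 1E *E u r +E 1E *E w r

      D : Column → Column → Eis
      D x y = det (A [ inject₁ i ≔ x ] [ suc i ≔ y ])

      i≢si : inject₁ i ≢ suc i
      i≢si = Finₚ.<⇒≢ (s≤s (ℕₚ.≤-reflexive (Finₚ.toℕ-inject₁ i)))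

      D-here : ∀ x y r → (A [ inject₁ i ≔ x ] [ suc i ≔ y ]) r (inject₁ i) ≡ x r
      D-here x y r = trans (≔-there (A [ inject₁ i ≔ x ]) y r i≢si) (≔-here A (inject₁ i) x r)

      D-diag : ∀ x → D x x ≡ 0E
      D-diag x = det-equal-adjacent (A [ inject₁ i ≔ x ] [ suc i ≔ x ]) i λ r →
        trans (D-here x x r) (sym (≔-here (A [ inject₁ i ≔ x ]) (suc i) x r))

      p≢q : p ≢ suc i
      p≢q = Finₚ.<⇒≢ p<q

      p<i : p Fin.< inject₁ i
      p<i = Finₚ.≤∧≢⇒< (subst (toℕ p ≤_) (sym (Finₚ.toℕ-inject₁ i)) (ℕₚ.≤-pred p<q)) p≢i

      D-w : D w u ≡ 0E
      D-w = ih p p<i (A [ inject₁ i ≔ w ] [ suc i ≔ u ]) λ r →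
        trans (≔-there (A [ inject₁ i ≔ w ]) u r p≢q)
          (trans (≔-there A w r p≢i) (trans (eq r) (sym (D-here w u r))))

      split : ∀ x → D x u+w ≡ 1E *E D x u +E 1E *E D x w
      split x = det-≔-linear (A [ inject₁ i ≔ x ]) (suc i) 1E 1E u w

      splitˡ : D u+w u+w ≡ 1E *E D u u+w +E 1E *E D w u+w
      -- The column to be split is the inner update, whereas `det-≔-linear` speaks of the outermost
      -- one.
      splitˡ = det-linear (A [ inject₁ i ≔ u ] [ suc i ≔ u+w ]) (A [ inject₁ i ≔ w ] [ suc i ≔ u+w ])
        (A [ inject₁ i ≔ u+w ] [ suc i ≔ u+w ]) (inject₁ i) 1E 1E (agree u) (agree w) λ r →
        trans (D-here u+w u+w r) (sym (cong₂ (λ a b → 1E *E a +E 1E *E b) (D-here u u+w r) (D-here w u+w r)))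
        where
        agree : ∀ x r c → c ≢ inject₁ i →
          (A [ inject₁ i ≔ x ] [ suc i ≔ u+w ]) r c ≡ (A [ inject₁ i ≔ u+w ] [ suc i ≔ u+w ]) r c
        agree x r c c≢i with c Fin.≟ suc i
        ... | yes _ = refl
        ... | no  _ = trans (≔-there A x r c≢i) (sym (≔-there A u+w r c≢i))

      A≈ : ∀ r c → A r c ≡ (A [ inject₁ i ≔ u ] [ suc i ≔ w ]) r c
      A≈ r c with c Fin.≟ suc i
      ... | yes refl = refl
      ... | no _ with c Fin.≟ inject₁ i
      ...   | yes refl = refl
      ...   | no _     = refl

det-equal-columns : ∀ {n} (A : Matrix n n) {p q} → p ≢ q → (∀ r → A r p ≡ A r q) → det A ≡ 0E
det-equal-columns {suc n} A {p} {q} p≢q eq =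
  [ (λ p<q → det-equal-< q p p<q A eq) , (λ q<p → det-equal-< p q q<p A (sym ∘ eq)) ]′ (<-or-> p≢q)
  where
  <-or-> : p ≢ q → p Fin.< q ⊎ q Fin.< p
  <-or-> p≢q with Finₚ.<-cmp p q
  ... | tri< p<q _ _ = inj₁ p<q
  ... | tri≈ _ p≡q _ = contradiction p≡q p≢q
  ... | tri> _ _ q<p = inj₂ q<p

-- Cramer's rule and kernel vectors

-- `A · x` is the combination of the columns of `A` with coefficients `x j`. By linearity in column
-- k the determinant splits, and each summand with j ≠ k contains column j twice.
cramer : ∀ {n} (A : Matrix n n) x k → det (A [ k ≔ A · x ]) ≡ x k *E det A
cramer A x k = begin
  det (A [ k ≔ A · x ])                              ≡⟨ det-≔-sum A k A x ⟩
  sumE (λ j → x j *E det (A [ k ≔ (λ r → A r j) ]))  ≡⟨ sumE-single k (λ j → x j *E det (A [ k ≔ (λ r → A r j) ])) off ⟩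
  x k *E det (A [ k ≔ (λ r → A r k) ])               ≡⟨ cong (x k *E_) (det-cong same) ⟩
  x k *E det A                                       ∎
  where
  open ≡-Reasoning
  off : ∀ j → j ≢ k → x j *E det (A [ k ≔ (λ r → A r j) ]) ≡ 0E
  off j j≢k = trans
    (cong (x j *E_) (det-equal-columns (A [ k ≔ (λ r → A r j) ]) j≢k
      (λ r → trans (≔-there A (λ r → A r j) r j≢k) (sym (≔-here A k (λ r → A r j) r)))))
    (E.zeroʳ (x j))
  same : ∀ r c → (A [ k ≔ (λ r → A r k) ]) r c ≡ A r c
  same r c with c Fin.≟ k
  ... | yes refl = refl
  ... | no _     = refl

-- Nonvanishing is recorded by a coordinate, because Cramer's rule is applied at the index of a
-- nonzero entry.
Kernel : ∀ {m n} → Matrix m n → Set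
Kernel {n = n} A = ∃ λ (x : Fin n → Eis) → (∃ λ k → x k ≢ 0E) × (∀ r → (A · x) r ≡ 0E)

-- Cramer's rule at a coordinate with `x k ≢ 0E`: the replaced column is zero, so `x k *E det A`
-- vanishes and `x k` cancels.
kernel⇒singular : ∀ {n} (A : Matrix n n) → Kernel A → det A ≡ 0E
kernel⇒singular A (x , (k , xk≢0) , Ax≡0) = x*y≡0∧x≢0⇒y≡0
  (trans (sym (cramer A x k))
    (det-zero-column (A [ k ≔ A · x ]) k (λ r → trans (≔-here A k (A · x) r) (Ax≡0 r))))
  xk≢0

·-linear : ∀ {m n} (A : Matrix m n) s t x y r →
  (A · (λ c → s *E x c +E t *E y c)) r ≡ s *E (A · x) r +E t *E (A · y) r
·-linear A s t x y r = trans
  (sumE-cong λ c → solve 5 (λ a s t x y → a ⊗ (s ⊗ x ⊕ t ⊗ y) ⊜ (s ⊗ (a ⊗ x) ⊕ t ⊗ (a ⊗ y))) refl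
    (A r c) s t (x c) (y c))
  (sumE-linear s t (λ c → A r c *E x c) (λ c → A r c *E y c))

·-insertAt : ∀ {m n} (A : Matrix m (suc n)) y k z r →
  (A · insertAt y k z) r ≡ A r k *E z +E sumE (λ c → A r (punchIn k c) *E y c)
·-insertAt A y k z r = trans (sumE-punchIn k (λ c → A r c *E insertAt y k z c))
  (cong₂ _+E_ (cong (A r k *E_) (Vecₚ.insertAt-lookup y k z))
    (sumE-cong λ c → cong (A r (punchIn k c) *E_) (Vecₚ.insertAt-punchIn y k z c)))

·-insertAt-0 : ∀ {m n} (A : Matrix m (suc n)) y k r →
  (A · insertAt y k 0E) r ≡ sumE (λ c → A r (punchIn k c) *E y c)
·-insertAt-0 A y k r = trans (·-insertAt A y k 0E r)
  (solve 2 (λ a s → (a ⊗ Κ 0E ⊕ s) ⊜ s) refl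
    (A r k) (sumE (λ c → A r (punchIn k c) *E y c)))

insertAt-0-≢0 : ∀ {n} (y : Fin n → Eis) k l → y l ≢ 0E → insertAt y k 0E (punchIn k l) ≢ 0E
insertAt-0-≢0 y k l yl≢0 eq = yl≢0 (trans (sym (Vecₚ.insertAt-punchIn y k 0E l)) eq)

x*y≢0 : ∀ {x y} → x ≢ 0E → y ≢ 0E → x *E y ≢ 0E
x*y≢0 x≢0 y≢0 eq = y≢0 (x*y≡0∧x≢0⇒y≡0 eq x≢0)

-- Fraction-free Gaussian elimination on the first row.
wide-kernel : ∀ {m} (A : Matrix m (suc m)) → Kernel A
wide-kernel {zero} A = (λ _ → 1E) , (zero , (λ ())) , (λ ())
wide-kernel {suc m} A = cases (Finₚ.any? (λ j → ¬? (A zero j ≟E 0E)))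
  where
  cases : Dec (∃ λ j → A zero j ≢ 0E) → Kernel A
  -- A zero first row imposes nothing. Dropping it together with one column restores the shape m ×
  -- (m + 1); the dropped coordinate is set to 0.
  cases (no all-zero) = insertAt y zero 0E , (punchIn zero l , insertAt-0-≢0 y zero l yl≢0) , kills
    where
    rec = wide-kernel (λ r c → A (suc r) (suc c))
    y = proj₁ rec
    l = proj₁ (proj₁ (proj₂ rec))
    yl≢0 = proj₂ (proj₁ (proj₂ rec))
    kills : ∀ r → (A · insertAt y zero 0E) r ≡ 0E
    kills zero = sumE-zero λ c → trans
      (cong (_*E insertAt y zero 0E c) (decidable-stable (A zero c ≟E 0E) (λ ≢0 → all-zero (c , ≢0))))
      (E.zeroˡ (insertAt y zero 0E c))
    kills (suc r) = trans (·-insertAt-0 A y zero (suc r)) (proj₂ (proj₂ rec) r)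
  cases (yes (j , a≢0)) = x , (punchIn j l , xl≢0) , kills
    where
    a = A zero j
    B : Matrix m (suc m)
    -- Pivot times the lower row minus its j-th entry times the first row; column j, which this
    -- would clear, is left out.
    B r c = a *E A (suc r) (punchIn j c) +E (-E A (suc r) j) *E A zero (punchIn j c)
    rec = wide-kernel B
    y = proj₁ rec
    l = proj₁ (proj₁ (proj₂ rec))
    T : Fin (suc m) → Eis
    T r = sumE (λ c → A r (punchIn j c) *E y c)
    x : Fin (suc (suc m)) → Eis
    -- With the other coordinates scaled by the pivot `a`, the first equation asks for a j-th
    -- coordinate v with a v + a `T zero` = 0, so v = -`T zero` solves it without division.
    x = insertAt (λ c → a *E y c) j (-E T zero)

    xl≢0 : x (punchIn j l) ≢ 0E
    xl≢0 eq = x*y≢0 a≢0 (proj₂ (proj₁ (proj₂ rec)))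
      (trans (sym (Vecₚ.insertAt-punchIn (λ c → a *E y c) j (-E T zero) l)) eq)

    row : ∀ r → (A · x) r ≡ a *E T r +E (-E A r j) *E T zero
    row r = trans (·-insertAt A (λ c → a *E y c) j (-E T zero) r) (trans
      (cong (A r j *E (-E T zero) +E_) (trans
        -- A summand with coefficient 0 is added so that the two-term `sumE-linear` can pull out the
        -- single factor `a`.
        (sumE-cong λ c → solve 3 (λ b a y → b ⊗ (a ⊗ y) ⊜ (a ⊗ (b ⊗ y) ⊕ Κ 0E ⊗ (b ⊗ y))) refl (A r (punchIn j c)) a (y c))
        (sumE-linear a 0E (λ c → A r (punchIn j c) *E y c) (λ c → A r (punchIn j c) *E y c))))
      (solve 4 (λ b t a s → (b ⊗ (⊝ t) ⊕ (a ⊗ s ⊕ Κ 0E ⊗ s)) ⊜ (a ⊗ s ⊕ (⊝ b) ⊗ t)) refl (A r j) (T zero) a (T r)))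

    kills : ∀ r → (A · x) r ≡ 0E
    kills zero = trans (row zero) (solve 2 (λ a t → (a ⊗ t ⊕ (⊝ a) ⊗ t) ⊜ Κ 0E) refl a (T zero))
    kills (suc r) = trans (row (suc r)) (trans
      (sym (trans
        (sumE-cong λ c → solve 5 (λ a b d e y → (a ⊗ b ⊕ d ⊗ e) ⊗ y ⊜ (a ⊗ (b ⊗ y) ⊕ d ⊗ (e ⊗ y))) refl
          a (A (suc r) (punchIn j c)) (-E A (suc r) j) (A zero (punchIn j c)) (y c))
        (sumE-linear a (-E A (suc r) j) (λ c → A (suc r) (punchIn j c) *E y c) (λ c → A zero (punchIn j c) *E y c))))
      (proj₂ (proj₂ rec) r))

signE≢0 : ∀ k → signE k ≢ 0E
signE≢0 zero    ()
signE≢0 (suc k) eq = signE≢0 k (trans (sym (solve 1 (λ x → (⊝ (⊝ x)) ⊜ x) refl (signE k))) (cong (λ x → -E x) eq))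

-- Every minor except the one at k retains the lower part of column k, which is zero.
det-column-e₀ : ∀ {n} (A : Matrix (suc n) (suc n)) k → (∀ r → A (suc r) k ≡ 0E) →
  det A ≡ signE (toℕ k) *E (A zero k *E det (minor A k))
det-column-e₀ A k eq = sumE-single k (λ j → signE (toℕ j) *E (A zero j *E det (minor A j))) off
  where
  off : ∀ j → j ≢ k → signE (toℕ j) *E (A zero j *E det (minor A j)) ≡ 0E
  off j j≢k = trans
    (cong (λ z → signE (toℕ j) *E (A zero j *E z))
      (det-zero-column (minor A j) (punchOut j≢k)
        (λ r → trans (cong (A (suc r)) (Finₚ.punchIn-punchOut j≢k)) (eq r))))
    (solve 2 (λ σ z → σ ⊗ (z ⊗ Κ 0E) ⊜ Κ 0E) refl (signE (toℕ j)) (A zero j))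

-- Take x ≠ 0 killed by all rows but the first, say with x k ≠ 0.  If the first
-- row does not kill x, Cramer's rule makes the minor at (0 , k) singular; its
-- kernel gives a second vector killed by the lower rows, with k-th entry 0, and a
-- combination of the two is killed by the first row as well.
singular⇒kernel : ∀ {n} (A : Matrix n n) → det A ≡ 0E → Kernel A
singular⇒kernel {zero} A ()
singular⇒kernel {suc n} A det≡0 = result (s ≟E 0E)
  where
  lower : Matrix n (suc n)
  lower r = A (suc r)
  wide = wide-kernel lower
  x = proj₁ wide
  k = proj₁ (proj₁ (proj₂ wide))
  xk≢0 = proj₂ (proj₁ (proj₂ wide))
  lower-x = proj₂ (proj₂ wide)
  s = (A · x) zero

  minor-singular : s ≢ 0E → det (minor A k) ≡ 0E
  minor-singular s≢0 = x*y≡0∧x≢0⇒y≡0 (x*y≡0∧x≢0⇒y≡0 expansion (signE≢0 (toℕ k))) s≢0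
    where
    open ≡-Reasoning
    A′ = A [ k ≔ A · x ]
    expansion : signE (toℕ k) *E (s *E det (minor A k)) ≡ 0E
    -- Column k of `A′` is (s, 0, ..., 0). Its determinant is evaluated both by expansion and by
    -- Cramer's rule.
    expansion = begin
      signE (toℕ k) *E (s *E det (minor A k))
        ≡⟨ cong (signE (toℕ k) *E_) (cong₂ _*E_ (sym (≔-here A k (A · x) zero))
             (det-cong (λ r c → sym (≔-there A (A · x) (suc r) (Finₚ.punchInᵢ≢i k c))))) ⟩
      signE (toℕ k) *E (A′ zero k *E det (minor A′ k))
        ≡⟨ sym (det-column-e₀ A′ k (λ r → trans (≔-here A k (A · x) (suc r)) (lower-x r))) ⟩
      det A′          ≡⟨ cramer A x k ⟩
      x k *E det A    ≡⟨ cong (x k *E_) det≡0 ⟩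
      x k *E 0E       ≡⟨ E.zeroʳ (x k) ⟩
      0E              ∎

  module _ (s≢0 : s ≢ 0E) where
    rec = singular⇒kernel (minor A k) (minor-singular s≢0)
    y = proj₁ rec
    l = proj₁ (proj₁ (proj₂ rec))
    yl≢0 = proj₂ (proj₁ (proj₂ rec))
    minor-y = proj₂ (proj₂ rec)
    y′ : Fin (suc n) → Eis
    y′ = insertAt y k 0E
    t = (A · y′) zero
    lower-y : ∀ r → (A · y′) (suc r) ≡ 0E
    lower-y r = trans (·-insertAt-0 A y k (suc r)) (minor-y r)
    z : Fin (suc n) → Eis
    z c = t *E x c +E (-E s) *E y′ c

    kills : ∀ r → (A · z) r ≡ 0E
    kills zero = trans (·-linear A t (-E s) x y′ zero)
      (solve 2 (λ s t → (t ⊗ s ⊕ (⊝ s) ⊗ t) ⊜ Κ 0E) refl s t)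
    kills (suc r) = trans (·-linear A t (-E s) x y′ (suc r)) (trans
      (cong₂ (λ a b → t *E a +E (-E s) *E b) (lower-x r) (lower-y r))
      (solve 2 (λ s t → (t ⊗ Κ 0E ⊕ (⊝ s) ⊗ Κ 0E) ⊜ Κ 0E) refl s t))

    zk : z k ≡ t *E x k
    zk = trans (cong (λ v → t *E x k +E (-E s) *E v) (Vecₚ.insertAt-lookup y k 0E))
      (solve 2 (λ a s → (a ⊕ (⊝ s) ⊗ Κ 0E) ⊜ a) refl (t *E x k) s)

    combine : Dec (t ≡ 0E) → Kernel A
    -- If t = 0, the entry `z k` vanishes and proves nothing about `z`, but `y′` itself is then
    -- killed by the first row. Otherwise `z k` is the nonzero product `t *E x k`.
    combine (yes t≡0) = y′ , (punchIn k l , insertAt-0-≢0 y k l yl≢0) , λ { zero → t≡0 ; (suc r) → lower-y r }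
    combine (no t≢0)  = z , (k , λ zk≡0 → x*y≢0 t≢0 xk≢0 (trans (sym zk) zk≡0)) , kills

  result : Dec (s ≡ 0E) → Kernel A
  result (yes s≡0) = x , (k , xk≢0) , λ { zero → s≡0 ; (suc r) → lower-x r }
  result (no s≢0)  = combine s≢0 (t s≢0 ≟E 0E)

-- The Hermitian form of the Laplacian

-- An edge of kind κ from i to j contributes |defect κ (x i) (x j)|² to x* L x.
defect : EdgeKind → Eis → Eis → Eis
defect none _ _ = 0E
defect κ    x y = x -E entryN κ *E y

:polarize : ∀ {n} → Eis → Eis → Eis[ n ] → Eis[ n ] → Polynomial n × Polynomial n
:polarize ν ν̄ x y =
  :⟨ x , x :-E conE ν :*E y ⟩ :+ :⟨ y , y :-E conE ν̄ :*E x ⟩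
    := :⟨ x :-E conE ν :*E y , x :-E conE ν :*E y ⟩

-- For a unit ν, multiplication by ν preserves the form, so ⟨y, y - ν̄x⟩ = ⟨νy, νy - x⟩; added to
-- ⟨x, x - νy⟩ this gives ⟨x - νy, x - νy⟩.
polarize : ∀ κ x y →
  ⟨ x , defect κ x y ⟩ ℤ.+ ⟨ y , defect (flipK κ) y x ⟩ ≡ ⟨ defect κ x y , defect κ x y ⟩
polarize none (mkE a b) (mkE c d) =
  ℤS.solve 4 (λ a b c d → :⟨ (a , b) , conE 0E ⟩ :+ :⟨ (c , d) , conE 0E ⟩ := :⟨ conE 0E , conE 0E ⟩) refl a b c d
polarize undir (mkE a b) (mkE c d) = ℤS.solve 4 (λ a b c d → :polarize 1E 1E (a , b) (c , d)) refl a b c d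
polarize fwd   (mkE a b) (mkE c d) = ℤS.solve 4 (λ a b c d → :polarize ωE ω̄E (a , b) (c , d)) refl a b c d
polarize bwd   (mkE a b) (mkE c d) = ℤS.solve 4 (λ a b c d → :polarize ω̄E ωE (a , b) (c , d)) refl a b c d

⟨⟩-+ʳ : ∀ x y z → ⟨ x , y +E z ⟩ ≡ ⟨ x , y ⟩ ℤ.+ ⟨ x , z ⟩
⟨⟩-+ʳ (mkE a b) (mkE c d) (mkE e f) = ℤS.solve 6
  (λ a b c d e f → :⟨ (a , b) , (c , d) :+E (e , f) ⟩ := (:⟨ (a , b) , (c , d) ⟩ :+ :⟨ (a , b) , (e , f) ⟩)) refl
  a b c d e f

⟨⟩-0ʳ : ∀ x → ⟨ x , 0E ⟩ ≡ + 0
⟨⟩-0ʳ (mkE a b) = ℤS.solve 2 (λ a b → :⟨ (a , b) , conE 0E ⟩ := con (+ 0)) refl a b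

⟨⟩-sum : ∀ {n} x (f : Fin n → Eis) → ⟨ x , sumE f ⟩ ≡ Σℤ.sum (λ j → ⟨ x , f j ⟩)
⟨⟩-sum {zero}  x f = ⟨⟩-0ʳ x
⟨⟩-sum {suc n} x f = trans (⟨⟩-+ʳ x (f zero) (sumE (f ∘ suc))) (cong (λ z → ⟨ x , f zero ⟩ ℤ.+ z) (⟨⟩-sum x (f ∘ suc)))

sum-nonneg : ∀ {n} (f : Fin n → ℤ) → (∀ i → + 0 ℤ.≤ f i) → + 0 ℤ.≤ Σℤ.sum f
sum-nonneg {zero}  f f≥0 = ℤₚ.≤-refl
sum-nonneg {suc n} f f≥0 = ℤₚ.+-mono-≤ (f≥0 zero) (sum-nonneg (f ∘ suc) (f≥0 ∘ suc))

sum-nonneg≡0 : ∀ {n} (f : Fin n → ℤ) → (∀ i → + 0 ℤ.≤ f i) → Σℤ.sum f ≡ + 0 → ∀ i → f i ≡ + 0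
sum-nonneg≡0 f f≥0 eq zero    = proj₁ (nonneg-+≡0 (f≥0 zero) (sum-nonneg (f ∘ suc) (f≥0 ∘ suc)) eq)
sum-nonneg≡0 f f≥0 eq (suc i) = sum-nonneg≡0 (f ∘ suc) (f≥0 ∘ suc)
  (proj₂ (nonneg-+≡0 (f≥0 zero) (sum-nonneg (f ∘ suc) (f≥0 ∘ suc)) eq)) i

fromℕE-sum : ∀ {n} (f : Fin n → ℕ) → fromℕE (sumℕ f) ≡ sumE (λ j → fromℕE (f j))
fromℕE-sum {zero}  f = refl
fromℕE-sum {suc n} f = cong (fromℕE (f zero) +E_) (fromℕE-sum (f ∘ suc))

-- The factor `isEdge κ` absorbs the separate clause of `defect` for nonadjacent pairs; summed over
-- j it produces the degree.
defect-edge : ∀ κ x y → defect κ x y ≡ x *E fromℕE (isEdge κ) +E (-E 1E) *E (entryN κ *E y)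
defect-edge none x y =
  solve 2 (λ x y → Κ 0E ⊜ (x ⊗ Κ 0E ⊕ Κ (-E 1E) ⊗ (Κ 0E ⊗ y))) refl x y
defect-edge undir x y =
  solve 2 (λ x y → (x ⊕ ⊝ (Κ 1E ⊗ y)) ⊜ (x ⊗ Κ 1E ⊕ Κ (-E 1E) ⊗ (Κ 1E ⊗ y))) refl x y
defect-edge fwd x y =
  solve 2 (λ x y → (x ⊕ ⊝ (Κ ωE ⊗ y)) ⊜ (x ⊗ Κ 1E ⊕ Κ (-E 1E) ⊗ (Κ ωE ⊗ y))) refl x y
defect-edge bwd x y =
  solve 2 (λ x y → (x ⊕ ⊝ (Κ ω̄E ⊗ y)) ⊜ (x ⊗ Κ 1E ⊕ Κ (-E 1E) ⊗ (Κ ω̄E ⊗ y))) refl x y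

module _ {n} (M : MixedGraph n) where

  DMat-diagonal : ∀ i → DMat M i i ≡ fromℕE (degree M i)
  DMat-diagonal i = cong (if_then fromℕE (degree M i) else 0E) (dec-true (i Fin.≟ i) refl)

  DMat-off-diagonal : ∀ i j → j ≢ i → DMat M i j ≡ 0E
  DMat-off-diagonal i j j≢i = cong (if_then fromℕE (degree M i) else 0E) (dec-false (i Fin.≟ j) (j≢i ∘ sym))

  LMat-· : ∀ x i → (LMat M · x) i ≡ sumE (λ j → defect (kind M i j) (x i) (x j))
  LMat-· x i = begin
    sumE (λ j → LMat M i j *E x j)
      ≡⟨ sumE-cong (λ j → solve 3 (λ d v x → (d ⊕ ⊝ v) ⊗ x ⊜ (Κ 1E ⊗ (d ⊗ x) ⊕ Κ (-E 1E) ⊗ (v ⊗ x))) refl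
           (DMat M i j) (NMat M i j) (x j)) ⟩
    sumE (λ j → 1E *E (DMat M i j *E x j) +E (-E 1E) *E (NMat M i j *E x j))
      ≡⟨ sumE-linear 1E (-E 1E) (λ j → DMat M i j *E x j) (λ j → NMat M i j *E x j) ⟩
    1E *E sumE (λ j → DMat M i j *E x j) +E (-E 1E) *E Nx
      ≡⟨ cong (λ z → 1E *E z +E (-E 1E) *E Nx) (sumE-single i (λ j → DMat M i j *E x j)
           (λ j j≢i → trans (cong (_*E x j) (DMat-off-diagonal i j j≢i)) (E.zeroˡ (x j)))) ⟩
    1E *E (DMat M i i *E x i) +E (-E 1E) *E Nx
      ≡⟨ cong (λ z → 1E *E (z *E x i) +E (-E 1E) *E Nx)
           (trans (DMat-diagonal i) (fromℕE-sum (λ j → isEdge (kind M i j)))) ⟩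
    1E *E (deg *E x i) +E (-E 1E) *E Nx
      ≡⟨ cong (_+E (-E 1E) *E Nx) (trans (E.*-identityˡ (deg *E x i)) (E.*-comm deg (x i))) ⟩
    x i *E deg +E (-E 1E) *E Nx
      ≡⟨ sumE-linear (x i) (-E 1E) (λ j → fromℕE (isEdge (kind M i j))) (λ j → NMat M i j *E x j) ⟨
    sumE (λ j → x i *E fromℕE (isEdge (kind M i j)) +E (-E 1E) *E (NMat M i j *E x j))
      ≡⟨ sumE-cong (λ j → defect-edge (kind M i j) (x i) (x j)) ⟨
    sumE (λ j → defect (kind M i j) (x i) (x j)) ∎
    where
    open ≡-Reasoning
    Nx  = sumE (λ j → NMat M i j *E x j)
    deg = sumE (λ j → fromℕE (isEdge (kind M i j)))

  -- The terms `Q i j` of the form x* L x have no definite sign, but adding the transposed term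
  -- gives the nonnegative `R i j`. The double sum of `R` is thus twice that of `Q`, namely 0, and
  -- each of its terms vanishes.
  kernel⇒defect≡0 : ∀ x → (∀ i → (LMat M · x) i ≡ 0E) → ∀ i j → defect (kind M i j) (x i) (x j) ≡ 0E
  kernel⇒defect≡0 x Lx≡0 i j = ⟨x,x⟩≡0⇒x≡0 (δ i j)
    (sum-nonneg≡0 (R i) (R≥0 i) (sum-nonneg≡0 (λ i → Σℤ.sum (R i)) (λ i → sum-nonneg (R i) (R≥0 i)) ΣΣR≡0 i) j)
    where
    open ≡-Reasoning
    δ : Fin n → Fin n → Eis
    δ i j = defect (kind M i j) (x i) (x j)
    Q R : Fin n → Fin n → ℤ
    Q i j = ⟨ x i , δ i j ⟩
    R i j = ⟨ δ i j , δ i j ⟩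

    R≥0 : ∀ i j → + 0 ℤ.≤ R i j
    R≥0 i j = ⟨x,x⟩-nonneg (δ i j)

    ΣQ≡0 : ∀ i → Σℤ.sum (Q i) ≡ + 0
    ΣQ≡0 i = begin
      Σℤ.sum (Q i)          ≡⟨ ⟨⟩-sum (x i) (δ i) ⟨
      ⟨ x i , sumE (δ i) ⟩  ≡⟨ cong (λ z → ⟨ x i , z ⟩) (trans (sym (LMat-· x i)) (Lx≡0 i)) ⟩
      ⟨ x i , 0E ⟩          ≡⟨ ⟨⟩-0ʳ (x i) ⟩
      + 0                   ∎

    ΣΣQ≡0 : Σℤ.sum (λ i → Σℤ.sum (Q i)) ≡ + 0
    ΣΣQ≡0 = trans (Σℤ.sum-cong-≗ ΣQ≡0) (Σℤ.sum-replicate-zero n)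

    R≡Q+Qᵀ : ∀ i j → R i j ≡ Q i j ℤ.+ Q j i
    R≡Q+Qᵀ i j = trans (sym (polarize (kind M i j) (x i) (x j)))
      (cong (λ κ → Q i j ℤ.+ ⟨ x j , defect κ (x j) (x i) ⟩) (sym (kind-flip M i j)))

    ΣΣR≡0 : Σℤ.sum (λ i → Σℤ.sum (R i)) ≡ + 0
    ΣΣR≡0 = begin
      Σℤ.sum (λ i → Σℤ.sum (R i))
        ≡⟨ Σℤ.sum-cong-≗ (λ i → trans (Σℤ.sum-cong-≗ (R≡Q+Qᵀ i)) (Σℤ.∑-distrib-+ (Q i) (λ j → Q j i))) ⟩
      Σℤ.sum (λ i → Σℤ.sum (Q i) ℤ.+ Σℤ.sum (λ j → Q j i))
        ≡⟨ Σℤ.∑-distrib-+ (λ i → Σℤ.sum (Q i)) (λ i → Σℤ.sum (λ j → Q j i)) ⟩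
      Σℤ.sum (λ i → Σℤ.sum (Q i)) ℤ.+ Σℤ.sum (λ i → Σℤ.sum (λ j → Q j i))
        ≡⟨ cong₂ ℤ._+_ ΣΣQ≡0 (trans (Σℤ.∑-comm (λ i j → Q j i)) ΣΣQ≡0) ⟩
      + 0 ∎

-- Labels as sixth roots of unity

-- Vertices of part a carry ω^{-a} rather than ω^a, because L x = 0 asks for
-- x i = ω x j along a directed edge from i to j.
ω̄^ : Fin 6 → Eis
ω̄^ zero                                   = 1E
ω̄^ (suc zero)                             = ω̄E
ω̄^ (suc (suc zero))                       = -E ωE
ω̄^ (suc (suc (suc zero)))                 = -E 1E
ω̄^ (suc (suc (suc (suc zero))))           = -E ω̄E
ω̄^ (suc (suc (suc (suc (suc zero)))))     = ωE

-- The values of `ω̄^` are all six units of ℤ[ω]. A finite search for c takes the place of exponent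
-- arithmetic modulo 6.
ω̄^-product : ∀ a b → ∃ λ c → ω̄^ a *E ω̄^ b ≡ ω̄^ c
ω̄^-product = from-yes (Finₚ.all? λ a → Finₚ.all? λ b → Finₚ.any? λ c → ω̄^ a *E ω̄^ b ≟E ω̄^ c)

SPcond⇒defect≡0 : ∀ κ a b → SPcond κ a b → defect κ (ω̄^ a) (ω̄^ b) ≡ 0E
SPcond⇒defect≡0 none  a b _ = refl
SPcond⇒defect≡0 undir =
  from-yes (Finₚ.all? λ a → Finₚ.all? λ b → (a Fin.≟ b) →-dec (defect undir (ω̄^ a) (ω̄^ b) ≟E 0E))
SPcond⇒defect≡0 fwd =
  from-yes (Finₚ.all? λ a → Finₚ.all? λ b → (b Fin.≟ next6 a) →-dec (defect fwd (ω̄^ a) (ω̄^ b) ≟E 0E))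
SPcond⇒defect≡0 bwd =
  from-yes (Finₚ.all? λ a → Finₚ.all? λ b → (a Fin.≟ next6 b) →-dec (defect bwd (ω̄^ a) (ω̄^ b) ≟E 0E))

-- Holds because the six units are pairwise distinct; each kind of edge is settled by checking all
-- 36 pairs of labels.
defect≡0⇒SPcond : ∀ κ a b → defect κ (ω̄^ a) (ω̄^ b) ≡ 0E → SPcond κ a b
defect≡0⇒SPcond none  a b _ = tt
defect≡0⇒SPcond undir =
  from-yes (Finₚ.all? λ a → Finₚ.all? λ b → (defect undir (ω̄^ a) (ω̄^ b) ≟E 0E) →-dec (a Fin.≟ b))
defect≡0⇒SPcond fwd =
  from-yes (Finₚ.all? λ a → Finₚ.all? λ b → (defect fwd (ω̄^ a) (ω̄^ b) ≟E 0E) →-dec (b Fin.≟ next6 a))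
defect≡0⇒SPcond bwd =
  from-yes (Finₚ.all? λ a → Finₚ.all? λ b → (defect bwd (ω̄^ a) (ω̄^ b) ≟E 0E) →-dec (a Fin.≟ next6 b))

-- A vertex is what makes the vector nonzero: on the empty graph SP holds vacuously while the
-- determinant is 1.
SP⇒kernel : ∀ {n} (M : MixedGraph (suc n)) → HasSP M → Kernel (LMat M)
SP⇒kernel M (p , sp) = (ω̄^ ∘ p) , (zero , ω̄^≢0 (p zero)) , λ i →
  trans (LMat-· M (ω̄^ ∘ p) i) (sumE-zero λ j → SPcond⇒defect≡0 (kind M i j) (p i) (p j) (sp i j))
  where
  ω̄^≢0 : ∀ a → ω̄^ a ≢ 0E
  ω̄^≢0 = from-yes (Finₚ.all? λ a → ¬? (ω̄^ a ≟E 0E))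

defect≡0⇒unit-multiple : ∀ κ x y → κ ≢ none → defect κ x y ≡ 0E → ∃ λ a → x ≡ ω̄^ a *E y
defect≡0⇒unit-multiple none  x y κ≢none _ = contradiction refl κ≢none
defect≡0⇒unit-multiple undir x y _ eq = zero , GroupProperties.x∙y⁻¹≈ε⇒x≈y E.+-group x (1E *E y) eq
-- The label is 5 because ω = ω̄⁵.
defect≡0⇒unit-multiple fwd   x y _ eq =
  suc (suc (suc (suc (suc zero)))) , GroupProperties.x∙y⁻¹≈ε⇒x≈y E.+-group x (ωE *E y) eq
defect≡0⇒unit-multiple bwd   x y _ eq = suc zero , GroupProperties.x∙y⁻¹≈ε⇒x≈y E.+-group x (ω̄E *E y) eq

defect-*ʳ : ∀ κ x y z → defect κ (x *E z) (y *E z) ≡ defect κ x y *E z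
defect-*ʳ none  x y z = sym (E.zeroˡ z)
defect-*ʳ undir x y z = solve 3 (λ x y z → (x ⊗ z ⊕ ⊝ (Κ 1E ⊗ (y ⊗ z))) ⊜ (x ⊕ ⊝ (Κ 1E ⊗ y)) ⊗ z) refl x y z
defect-*ʳ fwd   x y z = solve 3 (λ x y z → (x ⊗ z ⊕ ⊝ (Κ ωE ⊗ (y ⊗ z))) ⊜ (x ⊕ ⊝ (Κ ωE ⊗ y)) ⊗ z) refl x y z
defect-*ʳ bwd   x y z = solve 3 (λ x y z → (x ⊗ z ⊕ ⊝ (Κ ω̄E ⊗ (y ⊗ z))) ⊜ (x ⊕ ⊝ (Κ ω̄E ⊗ y)) ⊗ z) refl x y z

-- The label of i is read off the walk from vertex `zero` to i that connectedness supplies.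
-- Compatibility on edges off these walks comes from the defects, which vanish on every edge:
-- cancelling the common factor `x₀` leaves a relation between units.
kernel⇒SP : ∀ {n} (M : MixedGraph (suc n)) → Connected M → Kernel (LMat M) → HasSP M
kernel⇒SP M conn (x , (k , xk≢0) , Lx≡0) = p , λ i j → defect≡0⇒SPcond (kind M i j) (p i) (p j)
  (x*y≡0∧x≢0⇒y≡0 (trans (E.*-comm x₀ (defect (kind M i j) (ω̄^ (p i)) (ω̄^ (p j)))) (unscaled i j)) x₀≢0)
  where
  δ≡0 = kernel⇒defect≡0 M x Lx≡0
  x₀ = x zero

  adj-sym : ∀ {i j} → Adj M i j → Adj M j i
  adj-sym {i} {j} i~j eq = i~j (trans (kind-flip M j i) (cong flipK eq))

  along : ∀ {i j} → Star (Adj M) i j → ∃ λ a → x j ≡ ω̄^ a *E x i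
  along {i} ε = zero , sym (E.*-identityˡ (x i))
  along {i} {j} (_◅_ {j = l} i~l l⋯j) =
    -- The edge is read backwards, from l to i, since x l has to be expressed as a multiple of x i.
    compose (along l⋯j) (defect≡0⇒unit-multiple (kind M l i) (x l) (x i) (adj-sym i~l) (δ≡0 l i)) ω̄^-product
    where
    open ≡-Reasoning
    compose : (∃ λ a → x j ≡ ω̄^ a *E x l) → (∃ λ b → x l ≡ ω̄^ b *E x i) →
      (∀ a b → ∃ λ c → ω̄^ a *E ω̄^ b ≡ ω̄^ c) → ∃ λ c → x j ≡ ω̄^ c *E x i
    compose (a , xj≡) (b , xl≡) product = proj₁ (product a b) , (begin
      x j                                ≡⟨ xj≡ ⟩
      ω̄^ a *E x l                       ≡⟨ cong (ω̄^ a *E_) xl≡ ⟩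
      ω̄^ a *E (ω̄^ b *E x i)            ≡⟨ E.*-assoc (ω̄^ a) (ω̄^ b) (x i) ⟨
      ω̄^ a *E ω̄^ b *E x i              ≡⟨ cong (_*E x i) (proj₂ (product a b)) ⟩
      ω̄^ (proj₁ (product a b)) *E x i   ∎)

  p : Fin _ → Fin 6
  p i = proj₁ (along (conn zero i))

  x≡ : ∀ i → x i ≡ ω̄^ (p i) *E x₀
  x≡ i = proj₂ (along (conn zero i))

  x₀≢0 : x₀ ≢ 0E
  x₀≢0 eq = xk≢0 (trans (x≡ k) (trans (cong (ω̄^ (p k) *E_) eq) (E.zeroʳ (ω̄^ (p k)))))

  unscaled : ∀ i j → defect (kind M i j) (ω̄^ (p i)) (ω̄^ (p j)) *E x₀ ≡ 0E
  unscaled i j = begin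
    defect (kind M i j) (ω̄^ (p i)) (ω̄^ (p j)) *E x₀
      ≡⟨ defect-*ʳ (kind M i j) (ω̄^ (p i)) (ω̄^ (p j)) x₀ ⟨
    defect (kind M i j) (ω̄^ (p i) *E x₀) (ω̄^ (p j) *E x₀)
      ≡⟨ cong₂ (defect (kind M i j)) (x≡ i) (x≡ j) ⟨
    defect (kind M i j) (x i) (x j)
      ≡⟨ δ≡0 i j ⟩
    0E ∎
    where open ≡-Reasoning

theorem2p11 : (n : ℕ) → 1 ≤ n → (M : MixedGraph n) → Connected M →
    (HasSP M ⇔ Singular (LMat M))
theorem2p11 (suc n) _ M conn = mk⇔
  (λ sp → kernel⇒singular (LMat M) (SP⇒kernel M sp))
  (λ sing → kernel⇒SP M conn (singular⇒kernel (LMat M) sing))
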